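{- Let $h$ be the involution on labeled $\beta(1,0)$-trees defined recursively by $h(1,x)=(1,x)$, $h(\lambda((i,x),t))=\gamma((i,x),h(t))$, and $h(u\oplus v)=h(v)\oslash h(u)$. Then on labeled $\beta(1,0)$-trees with at least one edge, $h$ sends the tuple of word-valued statistics $(\mathtt{leaves},\mathtt{int},\mathtt{root},\mathtt{rpath},\mathtt{sub},\mathtt{rsub})$ to $(\mathtt{int},\mathtt{leaves},\mathtt{rpath},\mathtt{root},\mathtt{rsub},\mathtt{sub})$; that is, for every labeled $\beta(1,0)$-tree $t$ with at least one edge, $$\mathtt{leaves}\,t=\mathtt{int}\,h(t),\quad \mathtt{int}\,t=\mathtt{leaves}\,h(t),\quad \mathtt{root}\,t=\mathtt{rpath}\,h(t),$$ $$\mathtt{rpath}\,t=\mathtt{root}\,h(t),\quad \mathtt{sub}\,t=\mathtt{rsub}\,h(t),\quad \mathtt{rsub}\,t=\mathtt{sub}\,h(t).$$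
   Context: A $\beta(1,0)$-tree is a rooted plane tree (children of each node are linearly ordered left to right) whose nodes are labeled with positive integers such that: (1) leaves have label $1$; (2) the root has label equal to the sum of its children's labels; (3) any other non-leaf node has label no greater than the sum of its children's labels. The single-node tree with label $1$ is allowed (it is exempt from (2)). A labeled $\beta(1,0)$-tree is a $\beta(1,0)$-tree in which each node additionally carries a name (a letter of some alphabet), distinct nodes having distinct names; a node with integer label $i$ and name $x$ is written $(i,x)$, and $(1,x)$ also denotes the single-node tree with name $x$. $\operatorname{root} t$ is the integer label of the root. The right path of $t$ is the path from the root to the rightmost leaf (always go to the last child); $\operatorname{rpath} t$ is its number of edges. Operations on labeled $\beta(1,0)$-trees: - $u\oplus v$, for $u,v$ having at least one edge, whose roots have the same name and whose names are otherwise disjoint: identify the roots; the root of $u\oplus v$ keeps the common name and has integer label $\operatorname{root}u+\operatorname{root}v$, and the subtrees at the root are those of $u$ followed by those of $v$. - $\lambda((i,x),t)$, for $1\le i\le\operatorname{root}t$ and $x$ a name not in $t$: add a new root named $x$ whose only child is the old root; the new and the old root both get integer label $i$. - $u\oslash v$, for $u,v$ having at least one edge: identify the rightmost leaf of $u$ with the root of $v$; the identified node gets integer label $1$ and the name of the root of $v$ (the name of the rightmost leaf of $u$ is discarded); everything else is kept. The remaining names are assumed distinct. - $\gamma((i,x),t)$, for $t$ with at least one edge, $1\le i\le\operatorname{rpath}t$, and $x$ a name not in $t$: let $y$ be the $i$th node on the right path of $t$ (the root being the first); attach to $y$ a new last child, a leaf with integer label $1$ and name $x$, and add $1$ to the integer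 label of each node on the path from the root to $y$ (inclusive). By convention, $\gamma((1,x),(1,y))$ is the two-node tree with root $(1,y)$ and child $(1,x)$. The operations $\oplus$ and $\oslash$ are associative. Each labeled tree is of exactly one of the forms $(1,x)$, $\lambda((i,x),t)$, $u\oplus v$, and each tree with at least one edge is uniquely a $\oplus$-sum of one or more trees of the form $\lambda((i,x),s)$; so the recursion determines $h$. Statistics. $\mathtt{v}(t)$ is the word of names of the nodes of $t$ in preorder (root first, then subtrees from left to right); $w^r$ is the reverse of a word $w$. For a labeled $\beta(1,0)$-tree $t$ with at least one edge: - $\mathtt{leaves}\,t$ is the subword of $\mathtt{v}(t)$ consisting of the names of leaves. - $\mathtt{int}\,t$ is the subword of $\mathtt{v}(t)^r$ consisting of the names of internal (non-leaf) nodes. - $\mathtt{rpath}\,t$ is the subword of $\mathtt{v}(t)^r$ consisting of the names of the nodes on the right path, excluding the rightmost leaf. - $\mathtt{root}\,t$ is the subword of $\mathtt{leaves}\,t$ of length $\operatorname{root}t$ found by starting at the root and greedily and recursively searching for $\operatorname{root} t$ leaves in its subtrees, starting from the rightmost subtree and never searching for more leaves in a subtree than the integer label of the root of that subtree. Formally: $\mathtt{root}\,(1,x)=x$; $\mathtt{root}\,\lambda((i,x),t)$ is the word formed by the last $i$ letters of $\mathtt{root}\,t$; $\mathtt{root}(u\oplus v)$ is the concatenation of $\mathtt{root}\,u$ and $\mathtt{root}\,v$. - If $t=\lambda((i_1,x_1),t_1)\oplus\dots\oplus\lambda((i_k,x_k),t_k)$ is the unique such decomposition (so all $x_j$ equal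 the name of the root of $t$), then $\mathtt{sub}\,t=(\mathtt{v}(t_1),\dots,\mathtt{v}(t_k))$, a tuple of words. - If $t=\gamma((i_1,x_1),t_1)\oslash\dots\oslash\gamma((i_k,x_k),t_k)$ (such a decomposition exists, and $t_1,\dots,t_k$ are uniquely determined), then $\mathtt{rsub}\,t=(\mathtt{v}(t_k)^r,\dots,\mathtt{v}(t_1)^r)$. -}

module Defs where

open import Data.List using
  (List; []; _∷_; _++_; _∷ʳ_; map; filter; reverse; length; drop)
open import Data.List.Properties using (++-assoc; ++-identityʳ; map-++; reverse-++; unfold-reverse)
open import Data.List.Relation.Binary.Permutation.Propositional
  using (↭-sym; ↭⇒↭ₛ)
open import Data.List.Relation.Binary.Permutation.Propositional.Properties
  using (↭-reverse)
open import Data.List.Relation.Binary.Permutation.Setoid.Properties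
  using (Unique-resp-↭)
open import Data.List.Relation.Unary.All using (All; []; _∷_)
open import Data.List.Relation.Unary.All.Properties using (∷ʳ⁺)
open import Data.List.Relation.Unary.Unique.Propositional using (Unique)
open import Data.Nat using (ℕ; zero; suc; pred; _+_; _∸_; _≤_; z≤n; s≤s)
open import Data.Nat.ListAction using (sum)
open import Data.Nat.Properties using (+-suc; +-comm; +-identityʳ; ≤-trans; ≤-reflexive)
open import Data.Product using (_×_; _,_; map₁)
open import Function using (_∘_)
open import Relation.Binary.PropositionalEquality
  using (_≡_; refl; sym; trans; cong; cong₂; subst; setoid)
open import Relation.Nullary using (Dec; yes; no; ¬?)

------------------------------------------------------------------------
-- Labeled β(1,0)-trees

data Tree {a} (A : Set a) : Set a where
  node : (label : ℕ) (name : A) (children : List (Tree A)) → Tree A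

module _ {a} {A : Set a} where

  label : Tree A → ℕ
  label (node l _ _) = l

  name : Tree A → A
  name (node _ x _) = x

  children : Tree A → List (Tree A)
  children (node _ _ cs) = cs

  leaf : A → Tree A
  leaf x = node 1 x []

  relabel : ℕ → Tree A → Tree A
  relabel i (node _ x cs) = node i x cs

  labelSum : List (Tree A) → ℕ
  labelSum = sum ∘ map label

  data HasEdge : Tree A → Set a where
    hasEdge : ∀ {l x c cs} → HasEdge (node l x (c ∷ cs))

  data IsLeaf : Tree A → Set a where
    isLeaf : ∀ {l x} → IsLeaf (node l x [])

  isLeaf? : (t : Tree A) → Dec (IsLeaf t)
  isLeaf? (node _ _ [])      = yes isLeaf
  isLeaf? (node _ _ (_ ∷ _)) = no λ ()

  -- The label conditions on the subtree at a node other than the root.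
  data Inner : Tree A → Set a where
    innerLeaf : ∀ {x} → Inner (node 1 x [])
    innerNode : ∀ {l x c cs} → 1 ≤ l → l ≤ labelSum (c ∷ cs) →
                All Inner (c ∷ cs) → Inner (node l x (c ∷ cs))

  data IsβTree : Tree A → Set a where
    rootLeaf : ∀ {x} → IsβTree (node 1 x [])
    rootNode : ∀ {l x c cs} → 1 ≤ l → l ≡ labelSum (c ∷ cs) →
               All Inner (c ∷ cs) → IsβTree (node l x (c ∷ cs))

  mutual
    preorder : Tree A → List (Tree A)
    preorder t@(node _ _ cs) = t ∷ preorderᶠ cs

    preorderᶠ : List (Tree A) → List (Tree A)
    preorderᶠ []       = []
    preorderᶠ (c ∷ cs) = preorder c ++ preorderᶠ cs

  v : Tree A → List A
  v t = map name (preorder t)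

  IsLabeledβTree : Tree A → Set a
  IsLabeledβTree t = IsβTree t × Unique (v t)

  -- The nodes of the right path from the root down, without the rightmost
  -- leaf; so there are as many of them as edges on the right path.
  mutual
    rightPath : Tree A → List (Tree A)
    rightPath (node _ _ [])         = []
    rightPath t@(node _ _ (c ∷ cs)) = t ∷ rightPathᶠ c cs

    rightPathᶠ : Tree A → List (Tree A) → List (Tree A)
    rightPathᶠ c []       = rightPath c
    rightPathᶠ _ (d ∷ ds) = rightPathᶠ d ds

  rpathLength : Tree A → ℕ
  rpathLength = length ∘ rightPath

------------------------------------------------------------------------
-- Operations.  All four are totalised; outside the domains given in the
-- comments their values are irrelevant.

  infixr 6 _⊕_ _⊘_

  -- HasEdge u, HasEdge w, name u ≡ name w
  _⊕_ : Tree A → Tree A → Tree A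
  node l x cs ⊕ node m _ ds = node (l + m) x (cs ++ ds)

  -- 1 ≤ i ≤ label t
  lam : ℕ → A → Tree A → Tree A
  lam i x t = node i x (relabel i t ∷ [])

  -- HasEdge u, HasEdge w.  The first clause is the place where the rightmost
  -- leaf of u has been reached.
  mutual
    _⊘_ : Tree A → Tree A → Tree A
    node _ _ []       ⊘ w = relabel 1 w
    node l x (c ∷ cs) ⊘ w = node l x ((c ∷ cs) ⊘ᶠ w)

    _⊘ᶠ_ : List (Tree A) → Tree A → List (Tree A)
    []           ⊘ᶠ w = []
    (c ∷ [])     ⊘ᶠ w = c ⊘ w ∷ []
    (c ∷ d ∷ ds) ⊘ᶠ w = c ∷ (d ∷ ds) ⊘ᶠ w

  -- Attach e as new last child of the ith node on the right path, adding 1 to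
  -- the labels on the path from the root to that node.
  mutual
    attach : ℕ → Tree A → Tree A → Tree A
    attach 0             e t             = t
    attach 1             e (node l y cs) = node (suc l) y (cs ∷ʳ e)
    attach (suc (suc i)) e (node l y cs) = node (suc l) y (attachᶠ (suc i) e cs)

    attachᶠ : ℕ → Tree A → List (Tree A) → List (Tree A)
    attachᶠ i e []           = []
    attachᶠ i e (c ∷ [])     = attach i e c ∷ []
    attachᶠ i e (c ∷ d ∷ ds) = c ∷ attachᶠ i e (d ∷ ds)

  data γDomain : ℕ → Tree A → Set a where
    single : ∀ {x} → γDomain 1 (leaf x)
    edge   : ∀ {i t} → HasEdge t → 1 ≤ i → i ≤ rpathLength t → γDomain i t

  -- γDomain i t.  On a single node, attach would make the root label 2; the
  -- convention is that it stays 1.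
  γ : ℕ → A → Tree A → Tree A
  γ i x (node _ y [])         = node 1 y (leaf x ∷ [])
  γ i x t@(node _ _ (_ ∷ _)) = attach i (leaf x) t

------------------------------------------------------------------------
-- The map h.
--
-- A root x with children c₁, …, cₖ is lam l₁ x t₁ ⊕ … ⊕ lam lₖ x tₖ, where lⱼ
-- is the label of cⱼ and tⱼ is cⱼ with its original root label, which lam has
-- overwritten.  As h, v and rootWord do not depend on the label of the root,
-- they can be applied to cⱼ in place of tⱼ.  The lemmas h-lam, h-⊕,
-- rootWord-lam, rootWord-⊕, ⊕-parts-lam and ⊕-parts-⊕ below are the equations
-- in terms of lam and ⊕.

  mutual
    h : Tree A → Tree A
    h (node _ x [])       = leaf x
    h (node _ x (c ∷ cs)) = hᶠ x c cs

    hᶠ : A → Tree A → List (Tree A) → Tree A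
    hᶠ x c []       = γ (label c) x (h c)
    hᶠ x c (d ∷ ds) = hᶠ x d ds ⊘ γ (label c) x (h c)

------------------------------------------------------------------------
-- Statistics

  leaves : Tree A → List A
  leaves t = map name (filter isLeaf? (preorder t))

  int : Tree A → List A
  int t = map name (filter (¬? ∘ isLeaf?) (reverse (preorder t)))

  rpathWord : Tree A → List A
  rpathWord t = reverse (map name (rightPath t))

  lastN : ℕ → List A → List A
  lastN n w = drop (length w ∸ n) w

  mutual
    rootWord : Tree A → List A
    rootWord (node _ x [])       = x ∷ []
    rootWord (node _ _ (c ∷ cs)) = rootWordᶠ (c ∷ cs)

    rootWordᶠ : List (Tree A) → List A
    rootWordᶠ []       = []
    rootWordᶠ (c ∷ cs) = lastN (label c) (rootWord c) ++ rootWordᶠ cs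

  -- Give the root the only label it can have in a β(1,0)-tree.
  asRoot : Tree A → Tree A
  asRoot (node _ x [])       = leaf x
  asRoot (node _ x (c ∷ cs)) = node (labelSum (c ∷ cs)) x (c ∷ cs)

  -- t₁, …, tₖ such that t = lam i₁ x₁ t₁ ⊕ … ⊕ lam iₖ xₖ tₖ
  ⊕-parts : Tree A → List (Tree A)
  ⊕-parts t = map asRoot (children t)

  sub : Tree A → List (List A)
  sub t = map v (⊕-parts t)

  toList : Tree A × List (Tree A) → List (Tree A)
  toList (t , ts) = t ∷ ts

  -- t₁, …, tₖ such that t = γ i₁ x₁ t₁ ⊘ … ⊘ γ iₖ xₖ tₖ.  As γ makes the labels
  -- of the non-root internal nodes on the right path at least 2, whereas ⊘
  -- gives the identified node the label 1, the tree has to be cut at the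
  -- internal nodes on the right path with label 1.  From each piece, γ is
  -- undone by removing the rightmost leaf and subtracting 1 from the labels on
  -- the right path.  See γ-parts-γ and γ-parts-⊘ below.
  mutual
    cut : Tree A → Tree A × List (Tree A)
    cut (node l x [])       = node l x [] , []
    cut (node l x (c ∷ cs)) = map₁ (node (pred l) x) (cutᶠ c cs)

    cutᶠ : Tree A → List (Tree A) → List (Tree A) × List (Tree A)
    cutᶠ c                      (d ∷ ds) = map₁ (c ∷_) (cutᶠ d ds)
    cutᶠ (node _ _ [])          []       = [] , []
    cutᶠ c@(node 1 _ (_ ∷ _)) []       = [] , toList (cut c)
    cutᶠ c@(node _ _ (_ ∷ _)) []       = map₁ (_∷ []) (cut c)

  γ-parts : Tree A → List (Tree A)
  γ-parts t = map asRoot (toList (cut t))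

  rsub : Tree A → List (List A)
  rsub t = reverse (map (reverse ∘ v) (γ-parts t))

------------------------------------------------------------------------
-- The defining equations in terms of the operations

  h-lam : ∀ i x t → h (lam i x t) ≡ γ i x (h t)
  h-lam _ _ (node _ _ [])      = refl
  h-lam _ _ (node _ _ (_ ∷ _)) = refl

  relabel-⊘ : ∀ i u w → 1 ≡ i → relabel i u ⊘ w ≡ relabel i (u ⊘ w)
  relabel-⊘ _ (node _ _ [])      (node _ _ _) refl = refl
  relabel-⊘ _ (node _ _ (_ ∷ _)) _            refl = refl

  ⊘ᶠ-node : ∀ l x c cs u w →
            node l x ((c ∷ cs) ⊘ᶠ u) ⊘ w ≡ node l x (((c ∷ cs) ⊘ᶠ u) ⊘ᶠ w)
  ⊘ᶠ-node _ _ _ []      _ _ = refl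
  ⊘ᶠ-node _ _ _ (_ ∷ _) _ _ = refl

  mutual
    ⊘-assoc : ∀ t u w → (t ⊘ u) ⊘ w ≡ t ⊘ (u ⊘ w)
    ⊘-assoc (node _ _ [])       u w = relabel-⊘ 1 u w refl
    ⊘-assoc (node l x (c ∷ cs)) u w =
      trans (⊘ᶠ-node l x c cs u w) (cong (node l x) (⊘ᶠ-assoc (c ∷ cs) u w))

    ⊘ᶠ-assoc : ∀ ts u w → (ts ⊘ᶠ u) ⊘ᶠ w ≡ ts ⊘ᶠ (u ⊘ w)
    ⊘ᶠ-assoc []               u w = refl
    ⊘ᶠ-assoc (c ∷ [])         u w = cong (_∷ []) (⊘-assoc c u w)
    ⊘ᶠ-assoc (c ∷ d ∷ [])     u w = cong (c ∷_) (⊘ᶠ-assoc (d ∷ []) u w)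
    ⊘ᶠ-assoc (c ∷ d ∷ e ∷ es) u w = cong (c ∷_) (⊘ᶠ-assoc (d ∷ e ∷ es) u w)

  hᶠ-++ : ∀ x c cs d ds → hᶠ x c (cs ++ d ∷ ds) ≡ hᶠ x d ds ⊘ hᶠ x c cs
  hᶠ-++ x c []        d ds = refl
  hᶠ-++ x c (c′ ∷ cs) d ds =
    trans (cong (_⊘ γ (label c) x (h c)) (hᶠ-++ x c′ cs d ds))
          (⊘-assoc (hᶠ x d ds) (hᶠ x c′ cs) (γ (label c) x (h c)))

  h-⊕ : ∀ {u w} → HasEdge u → HasEdge w → name u ≡ name w →
        h (u ⊕ w) ≡ h w ⊘ h u
  h-⊕ {node _ x (c ∷ cs)} {node _ _ (d ∷ ds)} hasEdge hasEdge refl =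
    hᶠ-++ x c cs d ds

  rootWord-lam : ∀ i x t → rootWord (lam i x t) ≡ lastN i (rootWord t)
  rootWord-lam _ _ (node _ _ [])      = ++-identityʳ _
  rootWord-lam _ _ (node _ _ (_ ∷ _)) = ++-identityʳ _

  rootWordᶠ-++ : ∀ cs ds → rootWordᶠ (cs ++ ds) ≡ rootWordᶠ cs ++ rootWordᶠ ds
  rootWordᶠ-++ []       ds = refl
  rootWordᶠ-++ (c ∷ cs) ds =
    trans (cong (lastN (label c) (rootWord c) ++_) (rootWordᶠ-++ cs ds))
          (sym (++-assoc (lastN (label c) (rootWord c)) _ _))

  rootWord-⊕ : ∀ {u w} → HasEdge u → HasEdge w →
               rootWord (u ⊕ w) ≡ rootWord u ++ rootWord w
  rootWord-⊕ {node _ _ cs} {node _ _ ds} hasEdge hasEdge = rootWordᶠ-++ cs ds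

  asRoot-β : ∀ {t} → IsβTree t → asRoot t ≡ t
  asRoot-β rootLeaf            = refl
  asRoot-β (rootNode _ refl _) = refl

  ⊕-parts-lam : ∀ i x {t} → IsβTree t → ⊕-parts (lam i x t) ≡ t ∷ []
  ⊕-parts-lam _ _ rootLeaf            = refl
  ⊕-parts-lam _ _ (rootNode _ refl _) = refl

  ⊕-parts-⊕ : ∀ u w → ⊕-parts (u ⊕ w) ≡ ⊕-parts u ++ ⊕-parts w
  ⊕-parts-⊕ (node _ _ cs) (node _ _ ds) = map-++ asRoot cs ds

  -- cut undoes attach, provided that it cuts at e or that e is a leaf.
  mutual
    cut-attach : ∀ {i e t us} → cutᶠ e [] ≡ ([] , us) → All Inner (children t) →
                 1 ≤ i → i ≤ rpathLength t → cut (attach i e t) ≡ (t , us)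
    cut-attach {1} {t = node l x (c ∷ cs)} p q _ _ =
      cong (map₁ (node l x)) (cutᶠ-∷ʳ c cs p)
    cut-attach {suc (suc i)} {t = node l x (c ∷ cs)} p q _ (s≤s r) =
      cut-attachᶠ i c cs p q r

    cut-attachᶠ : ∀ {e us l x} i c cs → cutᶠ e [] ≡ ([] , us) →
                  All Inner (c ∷ cs) → suc i ≤ length (rightPathᶠ c cs) →
                  cut (node (suc l) x (attachᶠ (suc i) e (c ∷ cs)))
                    ≡ (node l x (c ∷ cs) , us)
    cut-attachᶠ {l = l} {x} i c [] p (q ∷ []) r =
      cong (map₁ (node l x)) (cutᶠ-attach i c p q r)
    cut-attachᶠ {l = l} {x} i c (d ∷ []) p (_ ∷ qs) r =
      cong (map₁ (λ where (node _ _ ds) → node l x (c ∷ ds)))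
           (cut-attachᶠ {l = l} {x} i d [] p qs r)
    cut-attachᶠ {l = l} {x} i c (d ∷ e ∷ es) p (_ ∷ qs) r =
      cong (map₁ (λ where (node _ _ ds) → node l x (c ∷ ds)))
           (cut-attachᶠ {l = l} {x} i d (e ∷ es) p qs r)

    cutᶠ-attach : ∀ {e us} i c → cutᶠ e [] ≡ ([] , us) → Inner c →
                  suc i ≤ rpathLength c →
                  cutᶠ (attach (suc i) e c) [] ≡ (c ∷ [] , us)
    cutᶠ-attach zero (node (suc l) x (c ∷ cs)) p (innerNode _ _ qs) r =
      cong (map₁ (_∷ [])) (cut-attach p qs (s≤s z≤n) r)
    cutᶠ-attach (suc i) (node (suc l) x (c ∷ [])) p (innerNode _ _ qs) r =
      cong (map₁ (_∷ [])) (cut-attach p qs (s≤s z≤n) r)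
    cutᶠ-attach (suc i) (node (suc l) x (c ∷ d ∷ ds)) p (innerNode _ _ qs) r =
      cong (map₁ (_∷ [])) (cut-attach p qs (s≤s z≤n) r)

    cutᶠ-∷ʳ : ∀ {e us} c cs → cutᶠ e [] ≡ ([] , us) →
              cutᶠ c (cs ∷ʳ e) ≡ (c ∷ cs , us)
    cutᶠ-∷ʳ c []       p = cong (map₁ (c ∷_)) p
    cutᶠ-∷ʳ c (d ∷ ds) p = cong (map₁ (c ∷_)) (cutᶠ-∷ʳ d ds p)

  mutual
    attach-⊘ : ∀ {x} i t u → i ≤ rpathLength t → 1 ≤ i →
               attach i (leaf x) t ⊘ u ≡ attach i (relabel 1 u) t
    attach-⊘ 1 (node l y (c ∷ cs)) u _ _ =
      cong (node (suc l) y) (∷ʳ-⊘ᶠ (c ∷ cs) u)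
    attach-⊘ {x} (suc (suc i)) (node l y (c ∷ cs)) u (s≤s r) _ =
      trans (node-attachᶠ-⊘ c cs) (cong (node (suc l) y) (attachᶠ-⊘ i c cs u r))
      where
      node-attachᶠ-⊘ : ∀ c cs →
        node (suc l) y (attachᶠ (suc i) (leaf x) (c ∷ cs)) ⊘ u
          ≡ node (suc l) y (attachᶠ (suc i) (leaf x) (c ∷ cs) ⊘ᶠ u)
      node-attachᶠ-⊘ _ []      = refl
      node-attachᶠ-⊘ _ (_ ∷ _) = refl

    attachᶠ-⊘ : ∀ {x} i c cs u → suc i ≤ length (rightPathᶠ c cs) →
                attachᶠ (suc i) (leaf x) (c ∷ cs) ⊘ᶠ u
                  ≡ attachᶠ (suc i) (relabel 1 u) (c ∷ cs)
    attachᶠ-⊘ i c []           u r =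
      cong (_∷ []) (attach-⊘ (suc i) c u r (s≤s z≤n))
    attachᶠ-⊘ i c (d ∷ [])     u r = cong (c ∷_) (attachᶠ-⊘ i d [] u r)
    attachᶠ-⊘ i c (d ∷ e ∷ es) u r = cong (c ∷_) (attachᶠ-⊘ i d (e ∷ es) u r)

    ∷ʳ-⊘ᶠ : ∀ {x} cs u → (cs ∷ʳ leaf x) ⊘ᶠ u ≡ cs ∷ʳ relabel 1 u
    ∷ʳ-⊘ᶠ []           u = refl
    ∷ʳ-⊘ᶠ (c ∷ [])     u = refl
    ∷ʳ-⊘ᶠ (c ∷ d ∷ ds) u = cong (c ∷_) (∷ʳ-⊘ᶠ (d ∷ ds) u)

  γ-parts-γ : ∀ {i t} x → γDomain i t → IsβTree t → γ-parts (γ i x t) ≡ t ∷ []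
  γ-parts-γ x single                   _              = refl
  γ-parts-γ x (edge hasEdge 1≤i i≤r) (rootNode p q r) =
    trans (cong (map asRoot ∘ toList) (cut-attach refl r 1≤i i≤r))
          (cong (_∷ []) (asRoot-β (rootNode p q r)))

  asRoot-label : ∀ l m x cs → asRoot (node l x cs) ≡ asRoot (node m x cs)
  asRoot-label _ _ _ []      = refl
  asRoot-label _ _ _ (_ ∷ _) = refl

  γ-parts-relabel : ∀ i u → γ-parts (relabel i u) ≡ γ-parts u
  γ-parts-relabel i (node _ _ [])       = refl
  γ-parts-relabel i (node l x (c ∷ cs)) =
    cong (_∷ _) (asRoot-label (pred i) (pred l) x _)

  γ-parts-⊘ : ∀ {i t u} x → γDomain i t → IsβTree t → HasEdge u →
              γ-parts (γ i x t ⊘ u) ≡ t ∷ γ-parts u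
  γ-parts-⊘ {u = u} x (single {y}) _ hasEdge =
    cong (leaf y ∷_) (γ-parts-relabel 1 u)
  γ-parts-⊘ {i} {t} {u} x (edge hasEdge 1≤i i≤r) (rootNode p q r) hasEdge =
    trans (cong γ-parts (attach-⊘ i t u i≤r 1≤i))
   (trans (cong (map asRoot ∘ toList) (cut-attach refl r 1≤i i≤r))
          (cong₂ _∷_ (asRoot-β (rootNode p q r)) (γ-parts-relabel 1 u)))

------------------------------------------------------------------------
-- h maps labeled β(1,0)-trees to labeled β(1,0)-trees, and applies γ and ⊘
-- within their domains only.

  attach-edge : ∀ i e {t} → HasEdge t → HasEdge (attach i e t)
  attach-edge 0             e hasEdge             = hasEdge
  attach-edge 1             e hasEdge             = hasEdge
  attach-edge (suc (suc i)) e (hasEdge {cs = []})    = hasEdge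
  attach-edge (suc (suc i)) e (hasEdge {cs = _ ∷ _}) = hasEdge

  γ-edge : ∀ i x t → HasEdge (γ i x t)
  γ-edge i x (node _ _ [])      = hasEdge
  γ-edge i x (node _ _ (_ ∷ _)) = attach-edge i (leaf x) hasEdge

  ⊘-edge : ∀ {u} w → HasEdge u → HasEdge (u ⊘ w)
  ⊘-edge w (hasEdge {cs = []})    = hasEdge
  ⊘-edge w (hasEdge {cs = _ ∷ _}) = hasEdge

  hᶠ-edge : ∀ x c cs → HasEdge (hᶠ x c cs)
  hᶠ-edge x c []       = γ-edge (label c) x (h c)
  hᶠ-edge x c (d ∷ ds) = ⊘-edge _ (hᶠ-edge x d ds)

  inner : ∀ {t} → HasEdge t → 1 ≤ label t → label t ≤ labelSum (children t) →
          All Inner (children t) → Inner t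
  inner hasEdge = innerNode

  βTree : ∀ {t} → HasEdge t → 1 ≤ label t → label t ≡ labelSum (children t) →
          All Inner (children t) → IsβTree t
  βTree hasEdge = rootNode

  label-attach : ∀ i e t → 1 ≤ i → label (attach i e t) ≡ suc (label t)
  label-attach 1             e (node _ _ _) _ = refl
  label-attach (suc (suc i)) e (node _ _ _) _ = refl

  labelSum-∷ʳ : ∀ cs x → labelSum (cs ∷ʳ leaf x) ≡ suc (labelSum cs)
  labelSum-∷ʳ []       x = refl
  labelSum-∷ʳ (c ∷ cs) x =
    trans (cong (label c +_) (labelSum-∷ʳ cs x)) (+-suc (label c) _)

  labelSum-attachᶠ : ∀ i e c cs → 1 ≤ i →
                     labelSum (attachᶠ i e (c ∷ cs)) ≡ suc (labelSum (c ∷ cs))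
  labelSum-attachᶠ i e c []       p = cong (_+ 0) (label-attach i e c p)
  labelSum-attachᶠ i e c (d ∷ ds) p =
    trans (cong (label c +_) (labelSum-attachᶠ i e d ds p)) (+-suc (label c) _)

  labelSum-attach : ∀ {i x t} → HasEdge t → 1 ≤ i →
                    labelSum (children (attach i (leaf x) t))
                      ≡ suc (labelSum (children t))
  labelSum-attach {1}             (hasEdge {c = c} {cs}) _ =
    labelSum-∷ʳ (c ∷ cs) _
  labelSum-attach {suc (suc i)}   (hasEdge {c = c} {cs}) _ =
    labelSum-attachᶠ (suc i) _ c cs (s≤s z≤n)

  mutual
    attach-children : ∀ {i x t} → HasEdge t → 1 ≤ i → i ≤ rpathLength t →
                      All Inner (children t) →
                      All Inner (children (attach i (leaf x) t))
    attach-children {1}           hasEdge _ _       ps = ∷ʳ⁺ ps innerLeaf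
    attach-children {suc (suc i)} hasEdge _ (s≤s q) ps = attachᶠ-inner q ps

    attachᶠ-inner : ∀ {i x c cs} → suc i ≤ length (rightPathᶠ c cs) →
                    All Inner (c ∷ cs) →
                    All Inner (attachᶠ (suc i) (leaf x) (c ∷ cs))
    attachᶠ-inner {cs = []}    q (p ∷ [])     = attach-inner q p ∷ []
    attachᶠ-inner {cs = _ ∷ _} q (p ∷ ps) = p ∷ attachᶠ-inner q ps

    attach-inner : ∀ {i x t} → suc i ≤ rpathLength t → Inner t →
                   Inner (attach (suc i) (leaf x) t)
    attach-inner {i} {x} {t} q (innerNode _ l≤ ps)
      = inner (attach-edge (suc i) (leaf x) hasEdge)
        (≤-trans (s≤s z≤n) (≤-reflexive (sym labelEq)))
        (≤-trans (≤-reflexive labelEq)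
          (≤-trans (s≤s l≤) (≤-reflexive (sym (labelSum-attach {suc i} {x} {t} hasEdge (s≤s z≤n))))))
        (attach-children hasEdge (s≤s z≤n) q ps)
      where labelEq = label-attach (suc i) (leaf x) t (s≤s z≤n)

  γ-β : ∀ {i t} x → γDomain i t → IsβTree t → IsβTree (γ i x t)
  γ-β x single _ = rootNode (s≤s z≤n) refl (innerLeaf ∷ [])
  γ-β {i} {t} x (edge hasEdge 1≤i i≤r) (rootNode _ l≡ ps) =
    βTree (attach-edge i (leaf x) hasEdge)
      (≤-trans (s≤s z≤n) (≤-reflexive (sym labelEq)))
      (trans labelEq
        (trans (cong suc l≡) (sym (labelSum-attach {i} {x} {t} hasEdge 1≤i))))
      (attach-children hasEdge 1≤i i≤r ps)
    where labelEq = label-attach i (leaf x) t 1≤i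

  labelSum-⊘ᶠ : ∀ {cs} w → All Inner cs → labelSum (cs ⊘ᶠ w) ≡ labelSum cs
  labelSum-⊘ᶠ                 w []                         = refl
  labelSum-⊘ᶠ (node _ _ _)    (innerLeaf ∷ [])             = refl
  labelSum-⊘ᶠ w               (innerNode _ _ _ ∷ [])       = refl
  labelSum-⊘ᶠ {c ∷ _ ∷ _} w   (_ ∷ ps@(_ ∷ _))             =
    cong (label c +_) (labelSum-⊘ᶠ w ps)

  mutual
    ⊘-inner : ∀ {u w} → Inner u → IsβTree w → Inner (u ⊘ w)
    ⊘-inner innerLeaf rootLeaf = innerLeaf
    ⊘-inner innerLeaf (rootNode 1≤l refl ps) = innerNode (s≤s z≤n) 1≤l ps
    ⊘-inner {u} {w} (innerNode 1≤l l≤ ps) q =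
      inner (⊘-edge w hasEdge) 1≤l
        (≤-trans l≤ (≤-reflexive (sym (labelSum-⊘ᶠ w ps)))) (⊘ᶠ-inner ps q)

    ⊘ᶠ-inner : ∀ {cs w} → All Inner cs → IsβTree w → All Inner (cs ⊘ᶠ w)
    ⊘ᶠ-inner []               q = []
    ⊘ᶠ-inner (p ∷ [])         q = ⊘-inner p q ∷ []
    ⊘ᶠ-inner (p ∷ ps@(_ ∷ _)) q = p ∷ ⊘ᶠ-inner ps q

  ⊘-β : ∀ {u w} → HasEdge u → IsβTree u → IsβTree w → IsβTree (u ⊘ w)
  ⊘-β {w = w} hasEdge (rootNode 1≤l l≡ ps) q =
    βTree (⊘-edge w hasEdge) 1≤l (trans l≡ (sym (labelSum-⊘ᶠ w ps)))
      (⊘ᶠ-inner ps q)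

  mutual
    rpathLength-attach : ∀ {x} i t → 1 ≤ i → i ≤ rpathLength t →
                         rpathLength (attach i (leaf x) t) ≡ i
    rpathLength-attach 1 (node _ _ (c ∷ cs)) _ _ =
      cong suc (rpathLengthᶠ-∷ʳ c cs)
    rpathLength-attach (suc (suc i)) (node l y (c ∷ cs)) _ (s≤s q) =
      rpathLength-attachᶠ (suc l) y i c cs q

    rpathLength-attachᶠ : ∀ {x} l y i c cs → suc i ≤ length (rightPathᶠ c cs) →
      rpathLength (node l y (attachᶠ (suc i) (leaf x) (c ∷ cs))) ≡ suc (suc i)
    rpathLength-attachᶠ l y i c []           q =
      cong suc (rpathLength-attach (suc i) c (s≤s z≤n) q)
    rpathLength-attachᶠ l y i c (d ∷ [])     q =
      rpathLength-attachᶠ l y i d [] q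
    rpathLength-attachᶠ l y i c (d ∷ e ∷ es) q =
      rpathLength-attachᶠ l y i d (e ∷ es) q

    rpathLengthᶠ-∷ʳ : ∀ {x} c cs → length (rightPathᶠ c (cs ∷ʳ leaf x)) ≡ 0
    rpathLengthᶠ-∷ʳ _ []       = refl
    rpathLengthᶠ-∷ʳ _ (d ∷ ds) = rpathLengthᶠ-∷ʳ d ds

  rpathLength-γ : ∀ {i t} x → γDomain i t → rpathLength (γ i x t) ≡ i
  rpathLength-γ             x single               = refl
  rpathLength-γ {i} {t} x (edge hasEdge 1≤i i≤r) =
    rpathLength-attach i t 1≤i i≤r

  mutual
    rpathLength-⊘ : ∀ u w → rpathLength (u ⊘ w) ≡ rpathLength u + rpathLength w
    rpathLength-⊘ (node _ _ [])       (node _ _ [])      = refl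
    rpathLength-⊘ (node _ _ [])       (node _ _ (_ ∷ _)) = refl
    rpathLength-⊘ (node l x (c ∷ cs)) w                  = rpathLength-⊘ᶠ l x c cs w

    rpathLength-⊘ᶠ : ∀ l x c cs w → rpathLength (node l x ((c ∷ cs) ⊘ᶠ w))
                       ≡ rpathLength (node l x (c ∷ cs)) + rpathLength w
    rpathLength-⊘ᶠ l x c []           w = cong suc (rpathLength-⊘ c w)
    rpathLength-⊘ᶠ l x c (d ∷ [])     w = rpathLength-⊘ᶠ l x d [] w
    rpathLength-⊘ᶠ l x c (d ∷ e ∷ es) w = rpathLength-⊘ᶠ l x d (e ∷ es) w

  mutual
    rpathLength-h : ∀ {t} → All Inner (children t) →
                    rpathLength (h t) ≡ labelSum (children t)
    rpathLength-h {node _ _ []}      _  = refl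
    rpathLength-h {node _ x (_ ∷ _)} ps = rpathLength-hᶠ x ps

    rpathLength-hᶠ : ∀ {c cs} x → All Inner (c ∷ cs) →
                     rpathLength (hᶠ x c cs) ≡ labelSum (c ∷ cs)
    rpathLength-hᶠ {c} {[]} x (p ∷ []) =
      trans (rpathLength-γ x (γDomain-h p)) (sym (+-identityʳ (label c)))
    rpathLength-hᶠ {c} {d ∷ ds} x (p ∷ ps) =
      trans (rpathLength-⊘ (hᶠ x d ds) _)
     (trans (cong₂ _+_ (rpathLength-hᶠ x ps) (rpathLength-γ x (γDomain-h p)))
            (+-comm (labelSum (d ∷ ds)) (label c)))

    γDomain-h : ∀ {c} → Inner c → γDomain (label c) (h c)
    γDomain-h innerLeaf = single
    γDomain-h (innerNode {c = c} {cs} 1≤l l≤ ps) =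
      edge (hᶠ-edge _ c cs) 1≤l
        (≤-trans l≤ (≤-reflexive (sym (rpathLength-hᶠ _ ps))))

  inner-children : ∀ {t} → Inner t → All Inner (children t)
  inner-children innerLeaf          = []
  inner-children (innerNode _ _ ps) = ps

  β-children : ∀ {t} → IsβTree t → All Inner (children t)
  β-children rootLeaf          = []
  β-children (rootNode _ _ ps) = ps

  mutual
    h-β : ∀ {t} → All Inner (children t) → IsβTree (h t)
    h-β {node _ _ []}      _  = rootLeaf
    h-β {node _ x (_ ∷ _)} ps = hᶠ-β x ps

    hᶠ-β : ∀ {c cs} x → All Inner (c ∷ cs) → IsβTree (hᶠ x c cs)
    hᶠ-β {c} {[]}     x (p ∷ []) =
      γ-β x (γDomain-h p) (h-β {c} (inner-children p))
    hᶠ-β {c} {d ∷ ds} x (p ∷ ps) =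
      ⊘-β (hᶠ-edge x d ds) (hᶠ-β x ps)
        (γ-β x (γDomain-h p) (h-β {c} (inner-children p)))

  vᶠ : List (Tree A) → List A
  vᶠ cs = map name (preorderᶠ cs)

  vᶠ-∷ : ∀ c cs → vᶠ (c ∷ cs) ≡ v c ++ vᶠ cs
  vᶠ-∷ c cs = map-++ name (preorder c) (preorderᶠ cs)

  vᶠ-[] : ∀ c → vᶠ (c ∷ []) ≡ v c
  vᶠ-[] c = trans (vᶠ-∷ c []) (++-identityʳ _)

  mutual
    v-attach : ∀ {x} i t → 1 ≤ i → i ≤ rpathLength t →
               v (attach i (leaf x) t) ≡ v t ∷ʳ x
    v-attach 1 (node _ y cs) _ _ = cong (y ∷_) (vᶠ-∷ʳ cs)
    v-attach (suc (suc i)) (node _ y (c ∷ cs)) _ (s≤s q) =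
      cong (y ∷_) (v-attachᶠ i c cs q)

    v-attachᶠ : ∀ {x} i c cs → suc i ≤ length (rightPathᶠ c cs) →
                vᶠ (attachᶠ (suc i) (leaf x) (c ∷ cs)) ≡ vᶠ (c ∷ cs) ∷ʳ x
    v-attachᶠ {x} i c [] q =
      trans (vᶠ-[] (attach (suc i) (leaf x) c))
     (trans (v-attach (suc i) c (s≤s z≤n) q)
            (cong (_∷ʳ x) (sym (vᶠ-[] c))))
    v-attachᶠ {x} i c (d ∷ ds) q =
      trans (vᶠ-∷ c (attachᶠ (suc i) (leaf x) (d ∷ ds)))
     (trans (cong (v c ++_) (v-attachᶠ i d ds q))
     (trans (sym (++-assoc (v c) _ _))
            (cong (_∷ʳ x) (sym (vᶠ-∷ c (d ∷ ds))))))

    vᶠ-∷ʳ : ∀ {x} cs → vᶠ (cs ∷ʳ leaf x) ≡ vᶠ cs ∷ʳ x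
    vᶠ-∷ʳ     []       = refl
    vᶠ-∷ʳ {x} (c ∷ cs) =
      trans (vᶠ-∷ c (cs ∷ʳ leaf x))
     (trans (cong (v c ++_) (vᶠ-∷ʳ cs))
     (trans (sym (++-assoc (v c) _ _)) (cong (_∷ʳ x) (sym (vᶠ-∷ c cs)))))

  v-γ : ∀ {i t} x → γDomain i t → v (γ i x t) ≡ v t ∷ʳ x
  v-γ             x single                 = refl
  v-γ {i} {t} x (edge hasEdge 1≤i i≤r) = v-attach i t 1≤i i≤r

  v-relabel : ∀ i t → v (relabel i t) ≡ v t
  v-relabel _ (node _ _ _) = refl

  dropLast : List A → List A
  dropLast []           = []
  dropLast (_ ∷ [])     = []
  dropLast (x ∷ y ∷ ys) = x ∷ dropLast (y ∷ ys)

  dropLast-∷ʳ : ∀ xs y → dropLast (xs ∷ʳ y) ≡ xs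
  dropLast-∷ʳ []           y = refl
  dropLast-∷ʳ (x ∷ [])     y = refl
  dropLast-∷ʳ (x ∷ z ∷ zs) y = cong (x ∷_) (dropLast-∷ʳ (z ∷ zs) y)

  dropLast-++ : ∀ xs y ys → dropLast (xs ++ y ∷ ys) ≡ xs ++ dropLast (y ∷ ys)
  dropLast-++ []           y ys = refl
  dropLast-++ (x ∷ [])     y ys = refl
  dropLast-++ (x ∷ z ∷ zs) y ys = cong (x ∷_) (dropLast-++ (z ∷ zs) y ys)

  mutual
    v-⊘ : ∀ u w → v (u ⊘ w) ≡ dropLast (v u) ++ v w
    v-⊘ (node _ _ [])                    w = v-relabel 1 w
    v-⊘ (node _ x (c@(node _ _ _) ∷ cs)) w = cong (x ∷_) (v-⊘ᶠ c cs w)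

    v-⊘ᶠ : ∀ c cs w → vᶠ ((c ∷ cs) ⊘ᶠ w) ≡ dropLast (vᶠ (c ∷ cs)) ++ v w
    v-⊘ᶠ c [] w =
      trans (vᶠ-[] (c ⊘ w))
     (trans (v-⊘ c w) (cong (λ us → dropLast us ++ v w) (sym (vᶠ-[] c))))
    v-⊘ᶠ c (d@(node _ _ _) ∷ ds) w =
      trans (vᶠ-∷ c ((d ∷ ds) ⊘ᶠ w))
     (trans (cong (v c ++_) (v-⊘ᶠ d ds w))
     (trans (sym (++-assoc (v c) _ _))
            (cong (_++ v w)
              (sym (trans (cong dropLast (vᶠ-∷ c (d ∷ ds)))
                          (dropLast-++ (v c) _ _))))))

  mutual
    v-h : ∀ {t} → All Inner (children t) → v (h t) ≡ reverse (v t)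
    v-h {node _ _ []}           _  = refl
    v-h {node _ x cs@(_ ∷ _)} ps =
      trans (v-hᶠ x ps) (sym (unfold-reverse x (vᶠ cs)))

    v-hᶠ : ∀ {c cs} x → All Inner (c ∷ cs) →
           v (hᶠ x c cs) ≡ reverse (vᶠ (c ∷ cs)) ∷ʳ x
    v-hᶠ {c} {[]} x (p ∷ []) =
      trans (v-γ x (γDomain-h p))
            (cong (_∷ʳ x) (trans (v-h {c} (inner-children p))
                                 (cong reverse (sym (vᶠ-[] c)))))
    v-hᶠ {c} {d ∷ ds} x (p ∷ ps) =
      trans (v-⊘ (hᶠ x d ds) (γ (label c) x (h c)))
     (trans (cong₂ _++_
              (trans (cong dropLast (v-hᶠ x ps)) (dropLast-∷ʳ _ x))
              (trans (v-γ x (γDomain-h p))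
                     (cong (_∷ʳ x) (v-h {c} (inner-children p)))))
     (trans (sym (++-assoc (reverse (vᶠ (d ∷ ds))) _ _))
            (cong (_∷ʳ x)
              (sym (trans (cong reverse (vᶠ-∷ c (d ∷ ds)))
                          (reverse-++ (v c) _))))))

  h-labeled : ∀ {t} → IsLabeledβTree t → IsLabeledβTree (h t)
  h-labeled {t} (p , q) =
    h-β {t} (β-children p) ,
    subst Unique (sym (v-h {t} (β-children p)))
      (Unique-resp-↭ (setoid A) (↭⇒↭ₛ (↭-sym (↭-reverse (v t)))) q)

{-# OPTIONS --safe #-}

-- Undoing γ and ⊘ on the right path is the mirror image of undoing λ and ⊕ at
-- the root: besides the defining equations one has h (γ i x t) = λ i x (h t) and
-- h (u ⊘ w) = h w ⊕ h u, so h is an involution.  It therefore suffices to follow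
-- leaves, root and sub through the recursion of h; the other three equations are
-- these three applied to h t.
module Submission where

open import Defs
open import Data.Bool using (true; false)
open import Data.List using
  (List; []; _∷_; _++_; _∷ʳ_; map; filter; reverse; length; drop; take)
open import Data.List.Properties using
  (++-assoc; ++-identityʳ; map-++; map-∘; map-cong-local; filter-++;
   reverse-++; reverse-map; reverse-involutive; length-reverse; length-drop;
   take++drop≡id; unfold-reverse)
open import Data.List.Relation.Unary.All as All using (All; []; _∷_)
open import Data.Nat using (ℕ; zero; suc; _+_; _∸_; _≤_; z≤n; s≤s)
open import Data.Nat.Properties using (+-suc; +-comm; +-identityʳ)
open import Data.Product using (_×_; _,_)
open import Function using (_∘_)
open import Relation.Binary.PropositionalEquality
  using (_≡_; refl; sym; trans; cong; cong₂; module ≡-Reasoning)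
open import Relation.Nullary using (¬?; does)
open import Relation.Unary using (Pred; Decidable)

open ≡-Reasoning

-- Filtering a reversed list.

filter-reverse : ∀ {a p} {A : Set a} {P : Pred A p} (P? : Decidable P) xs →
                 filter P? (reverse xs) ≡ reverse (filter P? xs)
filter-reverse P? []       = refl
filter-reverse P? (x ∷ xs) = begin
  filter P? (reverse (x ∷ xs))               ≡⟨ cong (filter P?) (unfold-reverse x xs) ⟩
  filter P? (reverse xs ∷ʳ x)                ≡⟨ filter-++ P? (reverse xs) (x ∷ []) ⟩
  filter P? (reverse xs) ++ filter P? (x ∷ [])
    ≡⟨ cong (_++ filter P? (x ∷ [])) (filter-reverse P? xs) ⟩
  reverse (filter P? xs) ++ filter P? (x ∷ []) ≡⟨ last ⟩
  reverse (filter P? (x ∷ xs))               ∎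
  where
  last : reverse (filter P? xs) ++ filter P? (x ∷ []) ≡ reverse (filter P? (x ∷ xs))
  last with does (P? x)
  ... | false = ++-identityʳ _
  ... | true  = sym (unfold-reverse x (filter P? xs))

module _ {a} {A : Set a} where

  -- h is an involution

  -- `γ` computes only on a visible list of children; trees such as `h t` are merely known to have
  -- an edge.
  γ-attach : ∀ i (x : A) {t} → HasEdge t → γ i x t ≡ attach i (leaf x) t
  γ-attach i x hasEdge = refl

  γDomain-≤ : ∀ {i} {t : Tree A} → HasEdge t → γDomain i t → i ≤ rpathLength t
  γDomain-≤ hasEdge (edge _ _ i≤r) = i≤r

  -- `attach`, `γ` and `⊘` on a `⊕`-sum, and `h` of a `⊘`-product.

  attachᶠ-++ : ∀ i (e : Tree A) cs d ds →
               attachᶠ i e (cs ++ d ∷ ds) ≡ cs ++ attachᶠ i e (d ∷ ds)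
  attachᶠ-++ i e []            d ds = refl
  attachᶠ-++ i e (c ∷ [])      d ds = refl
  attachᶠ-++ i e (c ∷ c′ ∷ cs) d ds = cong (c ∷_) (attachᶠ-++ i e (c′ ∷ cs) d ds)

  -- Apart from the shared root, the right path of `u ⊕ w` runs inside `w`; the root label `l + m`
  -- grows through its summand `m`.
  attach-⊕ : ∀ i (e : Tree A) {u w} → HasEdge u → HasEdge w →
             attach i e (u ⊕ w) ≡ u ⊕ attach i e w
  attach-⊕ 0 e hasEdge hasEdge = refl
  attach-⊕ 1 e {node l x cs} {node m _ ds} hasEdge hasEdge =
    cong₂ (λ k → node k x) (sym (+-suc l m)) (++-assoc cs ds _)
  attach-⊕ (suc (suc i)) e {node l x cs} {node m _ (d ∷ ds)} hasEdge hasEdge =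
    cong₂ (λ k → node k x) (sym (+-suc l m)) (attachᶠ-++ (suc i) e cs d ds)

  ⊕-edge : ∀ {u : Tree A} w → HasEdge u → HasEdge (u ⊕ w)
  ⊕-edge (node _ _ _) hasEdge = hasEdge

  γ-⊕ : ∀ i (x : A) {u w} → HasEdge u → HasEdge w → γ i x (u ⊕ w) ≡ u ⊕ γ i x w
  γ-⊕ i x {u} {w} p q = begin
    γ i x (u ⊕ w)             ≡⟨ γ-attach i x (⊕-edge w p) ⟩
    attach i (leaf x) (u ⊕ w) ≡⟨ attach-⊕ i (leaf x) p q ⟩
    u ⊕ attach i (leaf x) w   ≡⟨ cong (u ⊕_) (γ-attach i x q) ⟨
    u ⊕ γ i x w               ∎

  -- A leaf attached to the root is a one-edge summand. Its root name `y` is arbitrary because `⊕`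
  -- keeps the name of the left root.
  γ₁-⊕ : ∀ (x y : A) {t} → HasEdge t → γ 1 x t ≡ t ⊕ lam 1 y (leaf x)
  γ₁-⊕ x y {node l z cs} hasEdge = cong (λ k → node k z (cs ∷ʳ leaf x)) (+-comm 1 l)

  ⊘ᶠ-++ : ∀ cs d ds (w : Tree A) → (cs ++ d ∷ ds) ⊘ᶠ w ≡ cs ++ (d ∷ ds) ⊘ᶠ w
  ⊘ᶠ-++ []            d ds w = refl
  ⊘ᶠ-++ (c ∷ [])      d ds w = refl
  ⊘ᶠ-++ (c ∷ c′ ∷ cs) d ds w = cong (c ∷_) (⊘ᶠ-++ (c′ ∷ cs) d ds w)

  ⊕-⊘-assoc : ∀ {s t : Tree A} u → HasEdge s → HasEdge t → (s ⊕ t) ⊘ u ≡ s ⊕ (t ⊘ u)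
  ⊕-⊘-assoc {node l x cs} {node m _ (d ∷ ds)} u hasEdge hasEdge =
    cong (node (l + m) x) (⊘ᶠ-++ cs d ds u)

  h-edge : ∀ {t : Tree A} → HasEdge t → HasEdge (h t)
  h-edge (hasEdge {c = c} {cs}) = hᶠ-edge _ c cs

  -- Absorbs the reset to 1 that `⊘` makes at the identified node: `h` never reads the root label.
  h-relabel : ∀ i (t : Tree A) → h (relabel i t) ≡ h t
  h-relabel i (node _ _ [])      = refl
  h-relabel i (node _ _ (_ ∷ _)) = refl

  label-relabel : ∀ i (t : Tree A) → label (relabel i t) ≡ i
  label-relabel i (node _ _ _) = refl

  mutual
    -- Induction down the right path of `u`: each `γ` or `⊘` that `h` applies on the way up acts on
    -- the right summand only, so `h w` stays outside on the left. The root of `h u` is named after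
    -- the rightmost leaf of `u`, the name that both sides discard.
    h-⊘ : ∀ {u w : Tree A} → HasEdge u → HasEdge w → h (u ⊘ w) ≡ h w ⊕ h u
    h-⊘ {node l x (c ∷ cs)} hasEdge q = h-⊘ᶠ l x c cs q

    h-⊘ᶠ : ∀ l x c cs {w : Tree A} → HasEdge w →
           h (node l x ((c ∷ cs) ⊘ᶠ w)) ≡ h w ⊕ hᶠ x c cs
    h-⊘ᶠ l x (node _ y []) [] {w} q = begin
      -- The last child is now `w` with root label 1, so `γ` attaches `x` at the root of `h w`.
      γ (label (relabel 1 w)) x (h (relabel 1 w))
        ≡⟨ cong₂ (λ i → γ i x) (label-relabel 1 w) (h-relabel 1 w) ⟩
      γ 1 x (h w)               ≡⟨ γ₁-⊕ x y (h-edge q) ⟩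
      h w ⊕ lam 1 y (leaf x)    ∎
    h-⊘ᶠ l x c@(node k _ (_ ∷ _)) [] {w} q = begin
      γ k x (h (c ⊘ w))   ≡⟨ cong (γ k x) (h-⊘ {c} hasEdge q) ⟩
      γ k x (h w ⊕ h c)   ≡⟨ γ-⊕ k x (h-edge q) (h-edge {c} hasEdge) ⟩
      h w ⊕ γ k x (h c)   ∎
    h-⊘ᶠ l x c (d ∷ ds) {w} q = begin
      h (node l x (c ∷ (d ∷ ds) ⊘ᶠ w))
        ≡⟨ unfold ds ⟩
      h (node l x ((d ∷ ds) ⊘ᶠ w)) ⊘ γ (label c) x (h c)
        ≡⟨ cong (_⊘ γ (label c) x (h c)) (h-⊘ᶠ l x d ds q) ⟩
      (h w ⊕ hᶠ x d ds) ⊘ γ (label c) x (h c)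
        ≡⟨ ⊕-⊘-assoc _ (h-edge q) (hᶠ-edge x d ds) ⟩
      h w ⊕ hᶠ x c (d ∷ ds) ∎
      where
      -- `⊘ᶠ` shows its first element only after `ds` is split, and `hᶠ` needs it to choose a
      -- clause.
      unfold : ∀ ds → h (node l x (c ∷ (d ∷ ds) ⊘ᶠ w))
                    ≡ h (node l x ((d ∷ ds) ⊘ᶠ w)) ⊘ γ (label c) x (h c)
      unfold []      = refl
      unfold (_ ∷ _) = refl

  -- `attach`, `γ` and `⊘` on `lam`, and `h` of an attached leaf.

  relabel-attach : ∀ i j (e t : Tree A) →
                   attach (suc i) e (relabel j t) ≡ relabel (suc j) (attach (suc i) e t)
  relabel-attach zero    j e (node _ _ _) = refl
  relabel-attach (suc i) j e (node _ _ _) = refl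

  -- The new root shifts the right path by one node, hence `suc k` against `k`. Both the new and the
  -- old root carry `j` and lie above the attached leaf, so both labels become `suc j`. The bound
  -- `1 ≤ k` keeps the leaf off the new root.
  γ-lam : ∀ k j (x y : A) {t} → HasEdge t → 1 ≤ k →
          γ (suc k) y (lam j x t) ≡ lam (suc j) x (γ k y t)
  γ-lam (suc k) j x y {t@(node _ _ (_ ∷ _))} hasEdge _ =
    cong (λ s → node (suc j) x (s ∷ [])) (relabel-attach k j (leaf y) t)

  lam-⊘ : ∀ i (x : A) {t} u → HasEdge t → lam i x t ⊘ u ≡ lam i x (t ⊘ u)
  lam-⊘ i x u hasEdge = refl

  rpathLength-edge : ∀ {i} {t : Tree A} → suc i ≤ rpathLength t → HasEdge t
  rpathLength-edge {t = node _ _ (_ ∷ _)} _ = hasEdge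

  inner-label : ∀ {t : Tree A} → Inner t → 1 ≤ label t
  inner-label innerLeaf           = s≤s z≤n
  inner-label (innerNode 1≤l _ _) = 1≤l

  mutual
    h-attach : ∀ {x : A} i {t} → 1 ≤ i → i ≤ rpathLength t → All Inner (children t) →
               h (attach i (leaf x) t) ≡ lam i x (h t)
    -- The leaf is a new last child, so `hᶠ-++` puts `γ 1 y (leaf x)` in front, a root `x` over a
    -- leaf `y`. Grafting the rest onto that leaf, with label 1, is `lam 1 x`.
    h-attach {x} 1 {node l y (c ∷ cs)} _ _ _ = hᶠ-++ y c cs (leaf x) []
    h-attach (suc (suc i)) {node l y (c ∷ cs)} _ (s≤s q) ps =
      h-attachᶠ (suc l) y i c cs q ps

    -- `attach` adds 1 to the label of the last child, which raises the index of the `γ` that `h`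
    -- applies there. This makes up for the root that `lam` puts on top of the right path. Earlier
    -- children are grafted below that root.
    h-attachᶠ : ∀ {x : A} l y i c cs → suc i ≤ length (rightPathᶠ c cs) →
                All Inner (c ∷ cs) →
                h (node l y (attachᶠ (suc i) (leaf x) (c ∷ cs)))
                  ≡ lam (suc (suc i)) x (hᶠ y c cs)
    h-attachᶠ {x} l y i c [] q (p ∷ []) = begin
      γ (label (attach (suc i) (leaf x) c)) y (h (attach (suc i) (leaf x) c))
        ≡⟨ cong₂ (λ k → γ k y) (label-attach (suc i) (leaf x) c (s≤s z≤n))
                 (h-attach (suc i) (s≤s z≤n) q (inner-children p)) ⟩
      γ (suc (label c)) y (lam (suc i) x (h c))
        ≡⟨ γ-lam (label c) (suc i) x y (h-edge (rpathLength-edge {i} {c} q)) (inner-label p) ⟩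
      lam (suc (suc i)) x (γ (label c) y (h c)) ∎
    h-attachᶠ {x} l y i c (d ∷ ds) q (_ ∷ ps) = begin
      h (node l y (c ∷ attachᶠ (suc i) (leaf x) (d ∷ ds)))
        ≡⟨ unfold ds ⟩
      h (node l y (attachᶠ (suc i) (leaf x) (d ∷ ds))) ⊘ γ (label c) y (h c)
        ≡⟨ cong (_⊘ γ (label c) y (h c)) (h-attachᶠ l y i d ds q ps) ⟩
      lam (suc (suc i)) x (hᶠ y d ds) ⊘ γ (label c) y (h c)
        ≡⟨ lam-⊘ (suc (suc i)) x _ (hᶠ-edge y d ds) ⟩
      lam (suc (suc i)) x (hᶠ y c (d ∷ ds)) ∎
      where
      unfold : ∀ ds → h (node l y (c ∷ attachᶠ (suc i) (leaf x) (d ∷ ds)))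
                    ≡ h (node l y (attachᶠ (suc i) (leaf x) (d ∷ ds))) ⊘ γ (label c) y (h c)
      unfold []      = refl
      unfold (_ ∷ _) = refl

  h-γ : ∀ {i t} (x : A) → γDomain i t → IsβTree t → h (γ i x t) ≡ lam i x (h t)
  h-γ x single _ = refl
  h-γ {i} x (edge hasEdge 1≤i i≤r) p = h-attach i 1≤i i≤r (β-children p)

  lam-asRoot : ∀ (x : A) c → lam (label c) x (asRoot c) ≡ node (label c) x (c ∷ [])
  lam-asRoot x (node _ _ [])      = refl
  lam-asRoot x (node _ _ (_ ∷ _)) = refl

  mutual
    -- `h` forgets the root label, so applying it twice can only return the label prescribed by the
    -- children. Stated with `asRoot`, this also covers proper subtrees, as the recursion requires.
    h-h : ∀ {t : Tree A} → All Inner (children t) → h (h t) ≡ asRoot t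
    h-h {node _ _ []}      _  = refl
    h-h {node _ x (_ ∷ _)} ps = h-hᶠ x ps

    h-γ-h : ∀ {c} (x : A) → Inner c →
            h (γ (label c) x (h c)) ≡ node (label c) x (c ∷ [])
    h-γ-h {c} x p = begin
      h (γ (label c) x (h c))     ≡⟨ h-γ x (γDomain-h p) (h-β {t = c} (inner-children p)) ⟩
      lam (label c) x (h (h c))   ≡⟨ cong (lam (label c) x) (h-h {c} (inner-children p)) ⟩
      lam (label c) x (asRoot c)  ≡⟨ lam-asRoot x c ⟩
      node (label c) x (c ∷ [])   ∎

    h-hᶠ : ∀ {c cs} (x : A) → All Inner (c ∷ cs) →
           h (hᶠ x c cs) ≡ node (labelSum (c ∷ cs)) x (c ∷ cs)
    h-hᶠ {c} {[]} x (p ∷ []) = begin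
      h (γ (label c) x (h c))    ≡⟨ h-γ-h x p ⟩
      node (label c) x (c ∷ [])  ≡⟨ cong (λ k → node k x (c ∷ [])) (+-identityʳ (label c)) ⟨
      node (label c + 0) x (c ∷ []) ∎
    h-hᶠ {c} {d ∷ ds} x (p ∷ ps) = begin
      h (hᶠ x d ds ⊘ γ (label c) x (h c))
        -- The second reversal of the factors restores the order of the children.
        ≡⟨ h-⊘ (hᶠ-edge x d ds) (γ-edge (label c) x (h c)) ⟩
      h (γ (label c) x (h c)) ⊕ h (hᶠ x d ds)
        ≡⟨ cong₂ _⊕_ (h-γ-h x p) (h-hᶠ x ps) ⟩
      node (labelSum (c ∷ d ∷ ds)) x (c ∷ d ∷ ds) ∎

  h-involutive : ∀ {t : Tree A} → IsβTree t → h (h t) ≡ t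
  h-involutive {t} p = trans (h-h {t} (β-children p)) (asRoot-β p)

  -- sub and rsub

  v-asRoot : ∀ (t : Tree A) → v (asRoot t) ≡ v t
  v-asRoot (node _ _ [])      = refl
  v-asRoot (node _ _ (_ ∷ _)) = refl

  -- `hᶠ` nests `⊘` to the left, whereas `γ-parts-⊘` removes the leftmost `γ`; after reassociation
  -- the accumulator `u` takes up the later factors. The list is reversed because `hᶠ` starts from
  -- the last child.
  γ-parts-hᶠ-⊘ : ∀ {c cs u} (x : A) → All Inner (c ∷ cs) → HasEdge u →
                 γ-parts (hᶠ x c cs ⊘ u) ≡ reverse (map h (c ∷ cs)) ++ γ-parts u
  γ-parts-hᶠ-⊘ {c} {[]} x (p ∷ []) q =
    γ-parts-⊘ x (γDomain-h p) (h-β {t = c} (inner-children p)) q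
  γ-parts-hᶠ-⊘ {c} {d ∷ ds} {u} x (p ∷ ps) q = begin
    γ-parts ((hᶠ x d ds ⊘ g) ⊘ u)
      ≡⟨ cong γ-parts (⊘-assoc (hᶠ x d ds) g u) ⟩
    γ-parts (hᶠ x d ds ⊘ (g ⊘ u))
      ≡⟨ γ-parts-hᶠ-⊘ x ps (⊘-edge u (γ-edge (label c) x (h c))) ⟩
    reverse (map h (d ∷ ds)) ++ γ-parts (g ⊘ u)
      ≡⟨ cong (reverse (map h (d ∷ ds)) ++_)
              (γ-parts-⊘ x (γDomain-h p) (h-β {t = c} (inner-children p)) q) ⟩
    reverse (map h (d ∷ ds)) ++ h c ∷ γ-parts u
      ≡⟨ ++-assoc (reverse (map h (d ∷ ds))) (h c ∷ []) (γ-parts u) ⟨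
    (reverse (map h (d ∷ ds)) ∷ʳ h c) ++ γ-parts u
      ≡⟨ cong (_++ γ-parts u) (unfold-reverse (h c) (map h (d ∷ ds))) ⟨
    reverse (map h (c ∷ d ∷ ds)) ++ γ-parts u ∎
    where g = γ (label c) x (h c)

  γ-parts-hᶠ : ∀ {c cs} (x : A) → All Inner (c ∷ cs) →
               γ-parts (hᶠ x c cs) ≡ reverse (map h (c ∷ cs))
  γ-parts-hᶠ {c} {[]} x (p ∷ []) =
    γ-parts-γ x (γDomain-h p) (h-β {t = c} (inner-children p))
  γ-parts-hᶠ {c} {d ∷ ds} x (p ∷ ps) = begin
    γ-parts (hᶠ x d ds ⊘ g)
      ≡⟨ γ-parts-hᶠ-⊘ x ps (γ-edge (label c) x (h c)) ⟩
    reverse (map h (d ∷ ds)) ++ γ-parts g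
      ≡⟨ cong (reverse (map h (d ∷ ds)) ++_)
              (γ-parts-γ x (γDomain-h p) (h-β {t = c} (inner-children p))) ⟩
    reverse (map h (d ∷ ds)) ∷ʳ h c
      ≡⟨ unfold-reverse (h c) (map h (d ∷ ds)) ⟨
    reverse (map h (c ∷ d ∷ ds)) ∎
    where g = γ (label c) x (h c)

  reverse-v-h : ∀ {c : Tree A} → Inner c → reverse (v (h c)) ≡ v (asRoot c)
  reverse-v-h {c} p = begin
    reverse (v (h c))     ≡⟨ cong reverse (v-h {t = c} (inner-children p)) ⟩
    reverse (reverse (v c)) ≡⟨ reverse-involutive (v c) ⟩
    v c                   ≡⟨ v-asRoot c ⟨
    v (asRoot c)          ∎

  -- Of the two reversals in `rsub`, the outer one undoes the reversal of the children by `h`, the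
  -- inner one that of each preorder word.
  sub-h : ∀ {t : Tree A} → HasEdge t → IsβTree t → sub t ≡ rsub (h t)
  sub-h {t@(node _ x (c ∷ cs))} hasEdge (rootNode _ _ ps) = sym (begin
    reverse (map (reverse ∘ v) (γ-parts (hᶠ x c cs)))
      ≡⟨ cong (reverse ∘ map (reverse ∘ v)) (γ-parts-hᶠ x ps) ⟩
    reverse (map (reverse ∘ v) (reverse (map h (c ∷ cs))))
      ≡⟨ cong reverse (reverse-map (reverse ∘ v) (map h (c ∷ cs))) ⟩
    reverse (reverse (map (reverse ∘ v) (map h (c ∷ cs))))
      ≡⟨ reverse-involutive _ ⟩
    map (reverse ∘ v) (map h (c ∷ cs))
      ≡⟨ map-∘ (c ∷ cs) ⟨
    map (reverse ∘ v ∘ h) (c ∷ cs)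
      ≡⟨ map-cong-local (All.map reverse-v-h ps) ⟩
    map (v ∘ asRoot) (c ∷ cs)
      ≡⟨ map-∘ (c ∷ cs) ⟩
    sub t ∎)

  -- leaves and int

  leavesᶠ : List (Tree A) → List A
  leavesᶠ ts = map name (filter isLeaf? (preorderᶠ ts))

  leavesᶠ-∷ : ∀ c cs → leavesᶠ (c ∷ cs) ≡ leaves c ++ leavesᶠ cs
  leavesᶠ-∷ c cs = begin
    map name (filter isLeaf? (preorder c ++ preorderᶠ cs))
      ≡⟨ cong (map name) (filter-++ isLeaf? (preorder c) (preorderᶠ cs)) ⟩
    map name (filter isLeaf? (preorder c) ++ filter isLeaf? (preorderᶠ cs))
      ≡⟨ map-++ name (filter isLeaf? (preorder c)) _ ⟩
    leaves c ++ leavesᶠ cs ∎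

  -- `int` before its reversal: in preorder, the words of consecutive subtrees are simply
  -- concatenated.
  internal : Tree A → List A
  internal t = map name (filter (¬? ∘ isLeaf?) (preorder t))

  internalᶠ : List (Tree A) → List A
  internalᶠ ts = map name (filter (¬? ∘ isLeaf?) (preorderᶠ ts))

  int-internal : ∀ (t : Tree A) → int t ≡ reverse (internal t)
  int-internal t = begin
    map name (filter (¬? ∘ isLeaf?) (reverse (preorder t)))
      ≡⟨ cong (map name) (filter-reverse (¬? ∘ isLeaf?) (preorder t)) ⟩
    map name (reverse (filter (¬? ∘ isLeaf?) (preorder t)))
      ≡⟨ reverse-map name (filter (¬? ∘ isLeaf?) (preorder t)) ⟩
    reverse (internal t) ∎

  internalᶠ-∷ : ∀ c cs → internalᶠ (c ∷ cs) ≡ internal c ++ internalᶠ cs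
  internalᶠ-∷ c cs = begin
    map name (filter (¬? ∘ isLeaf?) (preorder c ++ preorderᶠ cs))
      ≡⟨ cong (map name) (filter-++ (¬? ∘ isLeaf?) (preorder c) (preorderᶠ cs)) ⟩
    map name (filter (¬? ∘ isLeaf?) (preorder c) ++ filter (¬? ∘ isLeaf?) (preorderᶠ cs))
      ≡⟨ map-++ name (filter (¬? ∘ isLeaf?) (preorder c)) _ ⟩
    internal c ++ internalᶠ cs ∎

  internalᶠ-[] : ∀ c → internalᶠ (c ∷ []) ≡ internal c
  internalᶠ-[] c = trans (internalᶠ-∷ c []) (++-identityʳ (internal c))

  -- The filter stalls on `attach i e t` and `u ⊘ w`, whose children are not visibly a cons;
  -- `HasEdge` settles that the root is internal.
  internal-edge : ∀ {t : Tree A} → HasEdge t → internal t ≡ name t ∷ internalᶠ (children t)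
  internal-edge hasEdge = refl

  internal-relabel : ∀ i t → internal (relabel i t) ≡ internal t
  internal-relabel i (node _ _ [])      = refl
  internal-relabel i (node _ _ (_ ∷ _)) = refl

  internalᶠ-∷ʳ : ∀ cs x → internalᶠ (cs ∷ʳ leaf x) ≡ internalᶠ cs
  internalᶠ-∷ʳ []       x = refl
  internalᶠ-∷ʳ (c ∷ cs) x = begin
    internalᶠ (c ∷ (cs ∷ʳ leaf x))         ≡⟨ internalᶠ-∷ c (cs ∷ʳ leaf x) ⟩
    internal c ++ internalᶠ (cs ∷ʳ leaf x) ≡⟨ cong (internal c ++_) (internalᶠ-∷ʳ cs x) ⟩
    internal c ++ internalᶠ cs             ≡⟨ internalᶠ-∷ c cs ⟨
    internalᶠ (c ∷ cs)                     ∎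

  mutual
    -- The new node is a leaf, and the bound on `i` puts its parent on `rightPath`, which omits the
    -- rightmost leaf; so no leaf turns internal.
    internal-attach : ∀ {x} i t → i ≤ rpathLength t →
                      internal (attach i (leaf x) t) ≡ internal t
    internal-attach 0 t _ = refl
    internal-attach {x} 1 (node l y (c ∷ cs)) _ = cong (y ∷_) (internalᶠ-∷ʳ (c ∷ cs) x)
    internal-attach {x} (suc (suc i)) t@(node l y (c ∷ cs)) (s≤s q) =
      trans (internal-edge (attach-edge (suc (suc i)) (leaf x) {t} hasEdge))
            (cong (y ∷_) (internalᶠ-attachᶠ i c cs q))

    internalᶠ-attachᶠ : ∀ {x} i c cs → suc i ≤ length (rightPathᶠ c cs) →
                        internalᶠ (attachᶠ (suc i) (leaf x) (c ∷ cs)) ≡ internalᶠ (c ∷ cs)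
    internalᶠ-attachᶠ {x} i c [] q = begin
      internalᶠ (attach (suc i) (leaf x) c ∷ []) ≡⟨ internalᶠ-[] (attach (suc i) (leaf x) c) ⟩
      internal (attach (suc i) (leaf x) c)       ≡⟨ internal-attach (suc i) c q ⟩
      internal c                                 ≡⟨ internalᶠ-[] c ⟨
      internalᶠ (c ∷ [])                         ∎
    internalᶠ-attachᶠ {x} i c (d ∷ ds) q = begin
      internalᶠ (c ∷ attachᶠ (suc i) (leaf x) (d ∷ ds))
        ≡⟨ internalᶠ-∷ c (attachᶠ (suc i) (leaf x) (d ∷ ds)) ⟩
      internal c ++ internalᶠ (attachᶠ (suc i) (leaf x) (d ∷ ds))
        ≡⟨ cong (internal c ++_) (internalᶠ-attachᶠ i d ds q) ⟩
      internal c ++ internalᶠ (d ∷ ds)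
        ≡⟨ internalᶠ-∷ c (d ∷ ds) ⟨
      internalᶠ (c ∷ d ∷ ds) ∎

  mutual
    -- The leaf of `u` that is replaced contributed nothing, so no letter is lost, in contrast to
    -- `v-⊘`.
    internal-⊘ : ∀ u w → internal (u ⊘ w) ≡ internal u ++ internal w
    internal-⊘ (node _ _ [])         w = internal-relabel 1 w
    internal-⊘ u@(node l x (c ∷ cs)) w =
      trans (internal-edge (⊘-edge {u = u} w hasEdge)) (cong (x ∷_) (internalᶠ-⊘ᶠ c cs w))

    internalᶠ-⊘ᶠ : ∀ c cs w →
                   internalᶠ ((c ∷ cs) ⊘ᶠ w) ≡ internalᶠ (c ∷ cs) ++ internal w
    internalᶠ-⊘ᶠ c [] w = begin
      internalᶠ (c ⊘ w ∷ [])           ≡⟨ internalᶠ-[] (c ⊘ w) ⟩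
      internal (c ⊘ w)                 ≡⟨ internal-⊘ c w ⟩
      internal c ++ internal w         ≡⟨ cong (_++ internal w) (internalᶠ-[] c) ⟨
      internalᶠ (c ∷ []) ++ internal w ∎
    internalᶠ-⊘ᶠ c (d ∷ ds) w = begin
      internalᶠ (c ∷ (d ∷ ds) ⊘ᶠ w)
        ≡⟨ internalᶠ-∷ c ((d ∷ ds) ⊘ᶠ w) ⟩
      internal c ++ internalᶠ ((d ∷ ds) ⊘ᶠ w)
        ≡⟨ cong (internal c ++_) (internalᶠ-⊘ᶠ d ds w) ⟩
      internal c ++ (internalᶠ (d ∷ ds) ++ internal w)
        ≡⟨ ++-assoc (internal c) (internalᶠ (d ∷ ds)) (internal w) ⟨
      (internal c ++ internalᶠ (d ∷ ds)) ++ internal w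
        ≡⟨ cong (_++ internal w) (internalᶠ-∷ c (d ∷ ds)) ⟨
      internalᶠ (c ∷ d ∷ ds) ++ internal w ∎

  mutual
    -- If `c` is a leaf, `γ` makes it the root of a two-node tree, hence internal. Otherwise `γ`
    -- creates no internal node, and the claim is the one for the children of `c`.
    leaves-internal-γ : ∀ {c} x → Inner c →
                        leaves c ≡ reverse (internal (γ (label c) x (h c)))
    leaves-internal-γ x innerLeaf = refl
    leaves-internal-γ x p@(innerNode {l} {y} {c} {cs} _ _ ps) = begin
      leavesᶠ (c ∷ cs)                      ≡⟨ leavesᶠ-internal-hᶠ y ps ⟩
      reverse (internal t)
        ≡⟨ cong reverse (internal-attach l t (γDomain-≤ (hᶠ-edge y c cs) (γDomain-h p))) ⟨
      reverse (internal (attach l (leaf x) t))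
        ≡⟨ cong (reverse ∘ internal) (γ-attach l x (hᶠ-edge y c cs)) ⟨
      reverse (internal (γ l x t))          ∎
      where t = hᶠ y c cs

    leavesᶠ-internal-hᶠ : ∀ {c cs} x → All Inner (c ∷ cs) →
                        leavesᶠ (c ∷ cs) ≡ reverse (internal (hᶠ x c cs))
    leavesᶠ-internal-hᶠ {c} {[]} x (p ∷ []) = begin
      leavesᶠ (c ∷ [])     ≡⟨ leavesᶠ-∷ c [] ⟩
      leaves c ++ []       ≡⟨ ++-identityʳ (leaves c) ⟩
      leaves c             ≡⟨ leaves-internal-γ x p ⟩
      reverse (internal (γ (label c) x (h c))) ∎
    leavesᶠ-internal-hᶠ {c} {d ∷ ds} x (p ∷ ps) = begin
      leavesᶠ (c ∷ d ∷ ds)             ≡⟨ leavesᶠ-∷ c (d ∷ ds) ⟩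
      leaves c ++ leavesᶠ (d ∷ ds)
        ≡⟨ cong₂ _++_ (leaves-internal-γ x p) (leavesᶠ-internal-hᶠ x ps) ⟩
      reverse (internal g) ++ reverse (internal (hᶠ x d ds))
        ≡⟨ reverse-++ (internal (hᶠ x d ds)) (internal g) ⟨
      reverse (internal (hᶠ x d ds) ++ internal g)
        ≡⟨ cong reverse (internal-⊘ (hᶠ x d ds) g) ⟨
      reverse (internal (hᶠ x d ds ⊘ g)) ∎
      where g = γ (label c) x (h c)

  leaves-h : ∀ {t : Tree A} → HasEdge t → IsβTree t → leaves t ≡ int (h t)
  leaves-h {t@(node _ x (c ∷ cs))} hasEdge (rootNode _ _ ps) = begin
    leavesᶠ (c ∷ cs)               ≡⟨ leavesᶠ-internal-hᶠ x ps ⟩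
    reverse (internal (h t))       ≡⟨ int-internal (h t) ⟨
    int (h t)                      ∎

  -- root and rpath

  rightNames : Tree A → List A
  rightNames t = map name (rightPath t)

  rightNamesᶠ : Tree A → List (Tree A) → List A
  rightNamesᶠ c cs = map name (rightPathᶠ c cs)

  rightPathᶠ-∷ʳ : ∀ (c : Tree A) cs e → rightPathᶠ c (cs ∷ʳ e) ≡ rightPath e
  rightPathᶠ-∷ʳ c []       e = refl
  rightPathᶠ-∷ʳ c (d ∷ ds) e = rightPathᶠ-∷ʳ d ds e

  mutual
    -- The new leaf ends the right path just below its `i`th node.
    rightNames-attach : ∀ {x} i t → 1 ≤ i → i ≤ rpathLength t →
                        rightNames (attach i (leaf x) t) ≡ take i (rightNames t)
    rightNames-attach {x} 1 (node l y (c ∷ cs)) _ _ =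
      cong (λ ts → y ∷ map name ts) (rightPathᶠ-∷ʳ c cs (leaf x))
    rightNames-attach (suc (suc i)) (node l y (c ∷ cs)) _ (s≤s q) =
      rightNames-attachᶠ (suc l) y i c cs q

    rightNames-attachᶠ : ∀ {x} l y i c cs → suc i ≤ length (rightPathᶠ c cs) →
                         rightNames (node l y (attachᶠ (suc i) (leaf x) (c ∷ cs)))
                           ≡ y ∷ take (suc i) (rightNamesᶠ c cs)
    rightNames-attachᶠ l y i c []           q =
      cong (y ∷_) (rightNames-attach (suc i) c (s≤s z≤n) q)
    rightNames-attachᶠ l y i c (d ∷ [])     q = rightNames-attachᶠ l y i d [] q
    rightNames-attachᶠ l y i c (d ∷ e ∷ es) q = rightNames-attachᶠ l y i d (e ∷ es) q

  mutual
    -- The identified node, being the rightmost leaf of `u`, can be counted only through `w`.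
    rightNames-⊘ : ∀ u w → rightNames (u ⊘ w) ≡ rightNames u ++ rightNames w
    rightNames-⊘ (node _ _ [])       (node _ _ [])      = refl
    rightNames-⊘ (node _ _ [])       (node _ _ (_ ∷ _)) = refl
    rightNames-⊘ (node l x (c ∷ cs)) w                  = rightNames-⊘ᶠ l x c cs w

    rightNames-⊘ᶠ : ∀ l x c cs w → rightNames (node l x ((c ∷ cs) ⊘ᶠ w))
                      ≡ x ∷ rightNamesᶠ c cs ++ rightNames w
    rightNames-⊘ᶠ l x c []           w = cong (x ∷_) (rightNames-⊘ c w)
    rightNames-⊘ᶠ l x c (d ∷ [])     w = rightNames-⊘ᶠ l x d [] w
    rightNames-⊘ᶠ l x c (d ∷ e ∷ es) w = rightNames-⊘ᶠ l x d (e ∷ es) w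

  drop-length-++ : ∀ (xs ys : List A) → drop (length xs) (xs ++ ys) ≡ ys
  drop-length-++ []       ys = refl
  drop-length-++ (x ∷ xs) ys = drop-length-++ xs ys

  lastN-reverse : ∀ n (w : List A) → lastN n (reverse w) ≡ reverse (take n w)
  lastN-reverse n w = begin
    drop (length (reverse w) ∸ n) (reverse w)
      ≡⟨ cong₂ drop lengthEq splitEq ⟩
    drop (length (reverse (drop n w))) (reverse (drop n w) ++ reverse (take n w))
      ≡⟨ drop-length-++ (reverse (drop n w)) _ ⟩
    reverse (take n w) ∎
    where
    -- Truncated subtraction also covers `n` beyond the length of `w`.
    lengthEq : length (reverse w) ∸ n ≡ length (reverse (drop n w))
    lengthEq = begin
      length (reverse w) ∸ n    ≡⟨ cong (_∸ n) (length-reverse w) ⟩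
      length w ∸ n              ≡⟨ length-drop n w ⟨
      length (drop n w)         ≡⟨ length-reverse (drop n w) ⟨
      length (reverse (drop n w)) ∎
    splitEq : reverse w ≡ reverse (drop n w) ++ reverse (take n w)
    splitEq = begin
      reverse w                     ≡⟨ cong reverse (take++drop≡id n w) ⟨
      reverse (take n w ++ drop n w) ≡⟨ reverse-++ (take n w) (drop n w) ⟩
      reverse (drop n w) ++ reverse (take n w) ∎

  mutual
    -- Passing to the parent keeps the last `label c` letters of the root word, while `γ` keeps the
    -- first `label c` nodes of the right path; the reversal in `rpathWord` matches the two.
    rootWord-γ : ∀ {c} x → Inner c →
                 lastN (label c) (rootWord c) ≡ rpathWord (γ (label c) x (h c))
    rootWord-γ x innerLeaf = refl
    rootWord-γ x p@(innerNode {l} {y} {c} {cs} 1≤l _ ps) = begin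
      lastN l (rootWordᶠ (c ∷ cs))        ≡⟨ cong (lastN l) (rootWordᶠ-hᶠ y ps) ⟩
      lastN l (reverse (rightNames t))    ≡⟨ lastN-reverse l (rightNames t) ⟩
      reverse (take l (rightNames t))
        ≡⟨ cong reverse (rightNames-attach l t 1≤l (γDomain-≤ (hᶠ-edge y c cs) (γDomain-h p))) ⟨
      rpathWord (attach l (leaf x) t)     ≡⟨ cong rpathWord (γ-attach l x (hᶠ-edge y c cs)) ⟨
      rpathWord (γ l x t)                 ∎
      where t = hᶠ y c cs

    rootWordᶠ-hᶠ : ∀ {c cs} x → All Inner (c ∷ cs) →
                   rootWordᶠ (c ∷ cs) ≡ rpathWord (hᶠ x c cs)
    rootWordᶠ-hᶠ {c} {[]} x (p ∷ []) = trans (++-identityʳ _) (rootWord-γ x p)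
    rootWordᶠ-hᶠ {c} {d ∷ ds} x (p ∷ ps) = begin
      lastN (label c) (rootWord c) ++ rootWordᶠ (d ∷ ds)
        ≡⟨ cong₂ _++_ (rootWord-γ x p) (rootWordᶠ-hᶠ x ps) ⟩
      reverse (rightNames g) ++ reverse (rightNames (hᶠ x d ds))
        ≡⟨ reverse-++ (rightNames (hᶠ x d ds)) (rightNames g) ⟨
      reverse (rightNames (hᶠ x d ds) ++ rightNames g)
        ≡⟨ cong reverse (rightNames-⊘ (hᶠ x d ds) g) ⟨
      rpathWord (hᶠ x d ds ⊘ g) ∎
      where g = γ (label c) x (h c)

  rootWord-h : ∀ {t : Tree A} → HasEdge t → IsβTree t → rootWord t ≡ rpathWord (h t)
  rootWord-h hasEdge (rootNode {x = x} _ _ ps) = rootWordᶠ-hᶠ x ps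

theorem7 : ∀ {a} {A : Set a} (t : Tree A) → IsLabeledβTree t → HasEdge t →
    leaves t ≡ int (h t)
    × int t ≡ leaves (h t)
    × rootWord t ≡ rpathWord (h t)
    × rpathWord t ≡ rootWord (h t)
    × sub t ≡ rsub (h t)
    × rsub t ≡ sub (h t)
theorem7 t (p , _) e =
    leaves-h e p
  , swap int (leaves-h e′ p′)
  , rootWord-h e p
  , swap rpathWord (rootWord-h e′ p′)
  , sub-h e p
  , swap rsub (sub-h e′ p′)
  where
  e′ : HasEdge (h t)
  e′ = h-edge e
  p′ : IsβTree (h t)
  p′ = h-β {t = t} (β-children p)
  -- Takes an equation stated at `h t` and replaces `h (h t)` on its right side by `t`.
  swap : ∀ {b} {B : Set b} (f : Tree _ → B) {y} → y ≡ f (h (h t)) → f t ≡ y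
  swap f eq = sym (trans eq (cong f (h-involutive p)))
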